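{- Let $n \ge 1$ and let $f:\{0,1\}^n\to\{0,1\}$ be such that $\|\hat f\|_1 = A$. Then there is an affine subspace $V\subseteq\{0,1\}^n$ of co-dimension at most $A^2$ such that $f$ is constant on $V$.
   Context: Identify $\{0,1\}^n$ with the vector space $\mathbb{Z}_2^n$ over $\mathbb{Z}_2$. For $\alpha\in\mathbb{Z}_2^n$ let $\chi_\alpha(x)=(-1)^{\sum_i\alpha_i x_i}$. For a real-valued function $f$ on $\mathbb{Z}_2^n$, its Fourier coefficients are $\hat f(\alpha)=\mathbb{E}_x[f(x)\chi_\alpha(x)]$ ($x$ uniform in $\mathbb{Z}_2^n$), so that $f=\sum_\alpha\hat f(\alpha)\chi_\alpha$. The spectral norm is $\|\hat f\|_1=\sum_{\alpha\in\mathbb{Z}_2^n}|\hat f(\alpha)|$. An affine subspace is a (nonempty) coset of a linear subspace. -}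

module Defs where

open import Data.Bool.Base using (Bool; true; false; _∧_; _xor_; if_then_else_)
open import Data.Integer.Base using (+_)
open import Data.Nat.Base as ℕ using (ℕ; zero; suc)
open import Data.Nat.Properties using (m^n≢0)
open import Data.Product.Base using (Σ-syntax; ∃-syntax; _×_)
open import Data.Rational.Base using (ℚ; 0ℚ; 1ℚ; -_; _+_; _*_; _/_; ∣_∣)
open import Data.Vec.Base using (Vec; []; _∷_; map; zipWith; replicate; foldr′)
open import Data.Vec.Relation.Unary.All using (All)
open import Level using (0ℓ)
open import Relation.Binary.PropositionalEquality using (_≡_)
open import Relation.Unary using (Pred; _∈_)

-- 𝔽₂ is Bool with _xor_ as addition and _∧_ as multiplication
-- (Data.Bool.Properties.xor-∧-commutativeRing).

Cube : ℕ → Set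
Cube n = Vec Bool n

private
  variable
    n k : ℕ

𝟎 : Cube n
𝟎 {n} = replicate n false

infixl 6 _⊕_
infixr 7 _·_

_⊕_ : Cube n → Cube n → Cube n
_⊕_ = zipWith _xor_

_·_ : Bool → Cube n → Cube n
c · x = map (c ∧_) x

⟨_,_⟩ : Cube n → Cube n → Bool
⟨ α , x ⟩ = foldr′ _xor_ false (zipWith _∧_ α x)

-- Functions on the cube are taken ℚ-valued rather than real-valued: for a
-- {0,1}-valued function every Fourier coefficient, and hence the spectral
-- norm, is rational.

∑ : (Cube n → ℚ) → ℚ
∑ {zero}  g = g []
∑ {suc n} g = ∑ (λ x → g (false ∷ x)) + ∑ (λ x → g (true ∷ x))

𝔼 : (Cube n → ℚ) → ℚ
𝔼 {n} g = (+ 1 / 2 ℕ.^ n) {{m^n≢0 2 n}} * ∑ g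

χ : Cube n → Cube n → ℚ
χ α x = if ⟨ α , x ⟩ then - 1ℚ else 1ℚ

fourier : (Cube n → ℚ) → Cube n → ℚ
fourier f α = 𝔼 (λ x → f x * χ α x)

spectralNorm : (Cube n → ℚ) → ℚ
spectralNorm f = ∑ (λ α → ∣ fourier f α ∣)

-- The numerical value of a bit, used to view f : {0,1}ⁿ → {0,1} as ℚ-valued.
bitℚ : Bool → ℚ
bitℚ b = if b then 1ℚ else 0ℚ

record Subspace (n : ℕ) : Set₁ where
  field
    member   : Pred (Cube n) 0ℓ
    𝟎-closed : 𝟎 ∈ member
    ⊕-closed : ∀ {x y} → x ∈ member → y ∈ member → x ⊕ y ∈ member
    ·-closed : ∀ c {x} → x ∈ member → c · x ∈ member

linComb : Vec Bool k → Vec (Cube n) k → Cube n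
linComb cs vs = foldr′ _⊕_ 𝟎 (zipWith _·_ cs vs)

LinearlyIndependent : Vec (Cube n) k → Set
LinearlyIndependent {k = k} vs =
  ∀ (cs : Vec Bool k) → linComb cs vs ≡ 𝟎 → cs ≡ replicate k false

record IsBasis (U : Subspace n) (vs : Vec (Cube n) k) : Set where
  field
    members     : All (_∈ Subspace.member U) vs
    independent : LinearlyIndependent vs
    spanning    : ∀ {x} → x ∈ Subspace.member U →
                  ∃[ cs ] linComb cs vs ≡ x

HasDimension : Subspace n → ℕ → Set
HasDimension {n} U d = Σ[ vs ∈ Vec (Cube n) d ] IsBasis U vs

record AffineSubspace (n : ℕ) : Set₁ where
  field
    base      : Cube n
    direction : Subspace n

infix 4 _∈ᵃ_

_∈ᵃ_ : Cube n → AffineSubspace n → Set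
x ∈ᵃ V = ∃[ u ] (u ∈ Subspace.member direction × x ≡ base ⊕ u)
  where open AffineSubspace V

HasCodimension : AffineSubspace n → ℕ → Set
HasCodimension {n} V c =
  ∃[ d ] (HasDimension (AffineSubspace.direction V) d × d ℕ.+ c ≡ n)

ConstantOn : (Cube n → Bool) → AffineSubspace n → Set
ConstantOn f V = ∃[ b ] (∀ x → x ∈ᵃ V → f x ≡ b)

{-# OPTIONS --safe #-}

-- Write a = f̂, p = a 𝟎, A = ∑ |a|. Passing to 1 − f if necessary, assume p ≤ 1/2;
-- this does not increase A. Let α ≠ 𝟎 maximise M = |a α| among nonzero α, and restrict
-- f to the hyperplane ⟨ α , x ⟩ ≡ b on which a α χ α = −M. The coefficients of the
-- restriction are the sums a γ ± a (γ ⊕ α). Since f² = f, ∑ a γ a (γ ⊕ α) = a α; apart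
-- from the pair {𝟎 , α} this leaves (1 − 2p) a α, so a lot of cancellation takes place
-- within the other pairs, all of whose entries are at most M. The norm therefore drops
-- by at least D = 1 − 2p + 2M, while p drops to p − M. Parseval, p = ∑ a², bounds M from
-- below, and D (2A − 1) ≥ 1 follows; so every restriction lowers A² by at least 1
-- and the process ends, after at most A² steps, with f vanishing.

module Submission where

open import Defs
open import Algebra.Bundles using (CommutativeRing)
import Algebra.Properties.CommutativeSemigroup as CommutativeSemigroupProperties
open import Data.Bool.Base using (Bool; true; false; not; _∧_; _xor_; if_then_else_)
open import Data.Bool.Properties using (xor-∧-commutativeRing; xor-same; ∧-identityʳ; not-injective)
open import Data.Integer.Base as ℤ using (+_)
import Data.Integer.Solver as ℤ-Solver
open import Data.Nat.Base as ℕ using (ℕ; zero; suc) renaming (_≤_ to _≤ℕ_)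
import Data.Nat.Properties as ℕ
open import Data.Product.Base using (Σ-syntax; ∃-syntax; _×_; _,_; proj₁; proj₂)
open import Data.Rational.Base
  using (ℚ; 0ℚ; 1ℚ; -_; _+_; _*_; _/_; ∣_∣; _≤_; _<_; toℚᵘ; fromℚᵘ; nonNegative; positive)
open import Data.Rational.Properties
import Data.Rational.Solver as ℚ-Solver
import Data.Rational.Unnormalised.Base as ℚᵘ
import Data.Rational.Unnormalised.Properties as ℚᵘ
open import Data.Sum.Base using (_⊎_; inj₁; inj₂)
open import Data.Vec.Base using (Vec; []; _∷_; map)
open import Data.Vec.Properties using (∷-injectiveʳ; ∷-injectiveˡ; map-id; map-const; zipWith-assoc)
open import Data.Vec.Relation.Unary.All using (universal)
open import Data.Vec.Relation.Unary.All.Properties using (map⁺)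
open import Function.Base using (_∘_; id)
open import Relation.Nullary using (¬_; contradiction)
open import Relation.Nullary.Decidable using (from-yes; from-no)
open import Relation.Binary.PropositionalEquality

open import Algebra.Properties.Ring +-*-ring using (-1*x≈-x; -‿involutive)

private
  module 𝔽₂ = CommutativeRing xor-∧-commutativeRing
  module ℚ-Ring = CommutativeRing +-*-commutativeRing

  variable
    d k m n : ℕ

open CommutativeSemigroupProperties 𝔽₂.+-commutativeSemigroup
  using () renaming (interchange to xor-interchange)
open CommutativeSemigroupProperties ℚ-Ring.+-commutativeSemigroup
  using () renaming (interchange to +-interchange)

-- Rational arithmetic: natural numbers as fractions and the weights `1 / 2 ^ n`.

fromℚᵘ-homo-+ : ∀ p q → fromℚᵘ p + fromℚᵘ q ≡ fromℚᵘ (p ℚᵘ.+ q)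
fromℚᵘ-homo-+ p q = toℚᵘ-injective (begin
  toℚᵘ (fromℚᵘ p + fromℚᵘ q)            ≈⟨ toℚᵘ-homo-+ (fromℚᵘ p) (fromℚᵘ q) ⟩
  toℚᵘ (fromℚᵘ p) ℚᵘ.+ toℚᵘ (fromℚᵘ q)  ≈⟨ ℚᵘ.+-cong (toℚᵘ-fromℚᵘ p) (toℚᵘ-fromℚᵘ q) ⟩
  p ℚᵘ.+ q                              ≈⟨ toℚᵘ-fromℚᵘ (p ℚᵘ.+ q) ⟨
  toℚᵘ (fromℚᵘ (p ℚᵘ.+ q))              ∎)
  where open ℚᵘ.≃-Reasoning

suc/1 : ∀ c → + suc c / 1 ≡ 1ℚ + + c / 1
suc/1 c = sym (trans (fromℚᵘ-homo-+ ℚᵘ.1ℚᵘ q)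
  -- `fromℚᵘ` of a `mkℚᵘ` unfolds to a fraction `_/_`, so only a cross-multiplied identity of
  -- integers remains.
  (fromℚᵘ-cong {ℚᵘ.1ℚᵘ ℚᵘ.+ q} {ℚᵘ.mkℚᵘ (+ suc c) 0} (ℚᵘ.*≡* (eq (+ c)))))
  where
  open ℤ-Solver.+-*-Solver
  q = ℚᵘ.mkℚᵘ (+ c) 0
  eq : ∀ e → (+ 1 ℤ.* + 1 ℤ.+ e ℤ.* + 1) ℤ.* + 1 ≡ (+ 1 ℤ.+ e) ℤ.* + 1
  eq = solve 1 (λ e → (con (+ 1) :* con (+ 1) :+ e :* con (+ 1)) :* con (+ 1)
                      := (con (+ 1) :+ e) :* con (+ 1)) refl

1/2d+1/2d : ∀ d .{{_ : ℕ.NonZero d}} .{{_ : ℕ.NonZero (2 ℕ.* d)}} →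
            + 1 / (2 ℕ.* d) + + 1 / (2 ℕ.* d) ≡ + 1 / d
1/2d+1/2d d@(suc k) = trans (fromℚᵘ-homo-+ half half)
  (fromℚᵘ-cong {half ℚᵘ.+ half} {ℚᵘ.mkℚᵘ (+ 1) k} (ℚᵘ.*≡* (eq (+ d))))
  where
  open ℤ-Solver.+-*-Solver
  half = ℚᵘ.mkℚᵘ (+ 1) (k ℕ.+ suc (k ℕ.+ 0))
  -- The trailing `+ 0` mirrors the unfolding of `2 ℕ.* d`.
  eq : ∀ e → let 2e = e ℤ.+ (e ℤ.+ + 0) in
       (+ 1 ℤ.* 2e ℤ.+ + 1 ℤ.* 2e) ℤ.* e ≡ + 1 ℤ.* (2e ℤ.* 2e)
  eq = solve 1 (λ e → let 2e = e :+ (e :+ con (+ 0)) in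
         (con (+ 1) :* 2e :+ con (+ 1) :* 2e) :* e := con (+ 1) :* (2e :* 2e)) refl

weight : ℕ → ℚ
weight n = (+ 1 / 2 ℕ.^ n) {{ℕ.m^n≢0 2 n}}

weight-suc : ∀ n → weight (suc n) + weight (suc n) ≡ weight n
weight-suc n = 1/2d+1/2d (2 ℕ.^ n) {{ℕ.m^n≢0 2 n}} {{ℕ.m^n≢0 2 (suc n)}}

open ℚ-Solver.+-*-Solver using (solve; _:=_; _:+_; _:*_; :-_; con)

-- Finite sums over the cube.

∑-cong : {F G : Cube n → ℚ} → (∀ x → F x ≡ G x) → ∑ F ≡ ∑ G
∑-cong {zero}  F≡G = F≡G []
∑-cong {suc n} F≡G =
  cong₂ _+_ (∑-cong λ x → F≡G (false ∷ x)) (∑-cong λ x → F≡G (true ∷ x))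

∑-+ : (F G : Cube n → ℚ) → ∑ (λ x → F x + G x) ≡ ∑ F + ∑ G
∑-+ {zero}  F G = refl
∑-+ {suc n} F G = trans
  (cong₂ _+_ (∑-+ (F ∘ (false ∷_)) (G ∘ (false ∷_))) (∑-+ (F ∘ (true ∷_)) (G ∘ (true ∷_))))
  (+-interchange (∑ (F ∘ (false ∷_))) (∑ (G ∘ (false ∷_))) _ _)

∑-*ˡ : (c : ℚ) (F : Cube n → ℚ) → ∑ (λ x → c * F x) ≡ c * ∑ F
∑-*ˡ {zero}  c F = refl
∑-*ˡ {suc n} c F = trans
  (cong₂ _+_ (∑-*ˡ c (F ∘ (false ∷_))) (∑-*ˡ c (F ∘ (true ∷_))))
  (sym (*-distribˡ-+ c _ _))

∑-*ʳ : (F : Cube n → ℚ) (c : ℚ) → ∑ (λ x → F x * c) ≡ ∑ F * c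
∑-*ʳ F c = trans (∑-cong λ x → *-comm (F x) c) (trans (∑-*ˡ c F) (*-comm c _))

∑-swap : ∀ {m n} (F : Cube m → Cube n → ℚ) →
         ∑ (λ x → ∑ (λ y → F x y)) ≡ ∑ (λ y → ∑ (λ x → F x y))
∑-swap {zero}  F = refl
∑-swap {suc m} F = trans
  (cong₂ _+_ (∑-swap (F ∘ (false ∷_))) (∑-swap (F ∘ (true ∷_))))
  (sym (∑-+ (λ y → ∑ (λ x → F (false ∷ x) y)) (λ y → ∑ (λ x → F (true ∷ x) y))))

∑-mono : {F G : Cube n → ℚ} → (∀ x → F x ≤ G x) → ∑ F ≤ ∑ G
∑-mono {zero}  F≤G = F≤G []
∑-mono {suc n} F≤G =
  +-mono-≤ (∑-mono λ x → F≤G (false ∷ x)) (∑-mono λ x → F≤G (true ∷ x))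

-- The constant coefficient obeys a different bound from the others, so its excess is charged to
-- `K`. The induction carries `K` down the `false` branch only, since no vector starting with `true`
-- is `𝟎`.
∑-mono-except-𝟎 : {F G : Cube n → ℚ} (K : ℚ) → (∀ x → x ≢ 𝟎 → F x ≤ G x) →
                  F 𝟎 ≤ G 𝟎 + K → ∑ F ≤ ∑ G + K
∑-mono-except-𝟎 {zero}  K F≤G F𝟎≤ = F𝟎≤
∑-mono-except-𝟎 {suc n} {F} {G} K F≤G F𝟎≤ = begin
  ∑ (F ∘ (false ∷_)) + ∑ (F ∘ (true ∷_))
    ≤⟨ +-mono-≤
         (∑-mono-except-𝟎 K (λ x x≢𝟎 → F≤G (false ∷ x) (x≢𝟎 ∘ ∷-injectiveʳ)) F𝟎≤)
         (∑-mono λ x → F≤G (true ∷ x) λ ()) ⟩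
  (∑ (G ∘ (false ∷_)) + K) + ∑ (G ∘ (true ∷_))
    ≡⟨ solve 3 (λ a k b → (a :+ k) :+ b := (a :+ b) :+ k) refl (∑ (G ∘ (false ∷_))) K _ ⟩
  (∑ (G ∘ (false ∷_)) + ∑ (G ∘ (true ∷_))) + K ∎
  where open ≤-Reasoning

∑-zero : ∑ {n} (λ _ → 0ℚ) ≡ 0ℚ
∑-zero {zero}  = refl
∑-zero {suc n} = cong₂ _+_ (∑-zero {n}) (∑-zero {n})

∣∑∣≤∑∣∣ : (F : Cube n → ℚ) → ∣ ∑ F ∣ ≤ ∑ (λ x → ∣ F x ∣)
∣∑∣≤∑∣∣ {zero}  F = ≤-refl
∣∑∣≤∑∣∣ {suc n} F = ≤-trans (∣p+q∣≤∣p∣+∣q∣ (∑ (F ∘ (false ∷_))) _)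
  (+-mono-≤ (∣∑∣≤∑∣∣ (F ∘ (false ∷_))) (∣∑∣≤∑∣∣ (F ∘ (true ∷_))))

∑-shift : (F : Cube n → ℚ) (a : Cube n) → ∑ (λ x → F (x ⊕ a)) ≡ ∑ F
∑-shift F []          = refl
∑-shift F (false ∷ a) = cong₂ _+_ (∑-shift (F ∘ (false ∷_)) a) (∑-shift (F ∘ (true ∷_)) a)
∑-shift F (true ∷ a)  = trans
  (cong₂ _+_ (∑-shift (F ∘ (true ∷_)) a) (∑-shift (F ∘ (false ∷_)) a))
  (+-comm (∑ (F ∘ (true ∷_))) _)

-- Fourier analysis on the cube


sgn : Bool → ℚ
sgn b = if b then - 1ℚ else 1ℚ

sgn-not : ∀ b → sgn (not b) ≡ - sgn b
sgn-not false = refl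
sgn-not true  = refl

sgn-xor : ∀ b c → sgn (b xor c) ≡ sgn b * sgn c
sgn-xor false c = sym (*-identityˡ (sgn c))
sgn-xor true  c = trans (sgn-not c) (sym (-1*x≈-x (sgn c)))

⟨⟩-⊕ʳ : (α x y : Cube n) → ⟨ α , x ⊕ y ⟩ ≡ ⟨ α , x ⟩ xor ⟨ α , y ⟩
⟨⟩-⊕ʳ []      []      []      = refl
⟨⟩-⊕ʳ (a ∷ α) (b ∷ x) (c ∷ y) = trans
  (cong₂ _xor_ (𝔽₂.distribˡ a b c) (⟨⟩-⊕ʳ α x y))
  (xor-interchange (a ∧ b) (a ∧ c) ⟨ α , x ⟩ ⟨ α , y ⟩)

⟨⟩-comm : (α x : Cube n) → ⟨ α , x ⟩ ≡ ⟨ x , α ⟩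
⟨⟩-comm []      []      = refl
⟨⟩-comm (a ∷ α) (b ∷ x) = cong₂ _xor_ (𝔽₂.*-comm a b) (⟨⟩-comm α x)

⟨⟩-⊕ˡ : (α β x : Cube n) → ⟨ α ⊕ β , x ⟩ ≡ ⟨ α , x ⟩ xor ⟨ β , x ⟩
⟨⟩-⊕ˡ α β x = begin
  ⟨ α ⊕ β , x ⟩            ≡⟨ ⟨⟩-comm (α ⊕ β) x ⟩
  ⟨ x , α ⊕ β ⟩            ≡⟨ ⟨⟩-⊕ʳ x α β ⟩
  ⟨ x , α ⟩ xor ⟨ x , β ⟩  ≡⟨ cong₂ _xor_ (⟨⟩-comm x α) (⟨⟩-comm x β) ⟩
  ⟨ α , x ⟩ xor ⟨ β , x ⟩  ∎
  where open ≡-Reasoning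

⟨𝟎,-⟩ : (x : Cube n) → ⟨ 𝟎 , x ⟩ ≡ false
⟨𝟎,-⟩ []      = refl
⟨𝟎,-⟩ (_ ∷ x) = ⟨𝟎,-⟩ x

⊕-identityˡ : (x : Cube n) → 𝟎 ⊕ x ≡ x
⊕-identityˡ []      = refl
⊕-identityˡ (b ∷ x) = cong (b ∷_) (⊕-identityˡ x)

⊕-identityʳ : (x : Cube n) → x ⊕ 𝟎 ≡ x
⊕-identityʳ []      = refl
⊕-identityʳ (b ∷ x) = cong₂ _∷_ (𝔽₂.+-identityʳ b) (⊕-identityʳ x)

χ-⊕ : (γ δ x : Cube n) → χ (γ ⊕ δ) x ≡ χ γ x * χ δ x
χ-⊕ γ δ x = trans (cong sgn (⟨⟩-⊕ˡ γ δ x)) (sgn-xor ⟨ γ , x ⟩ ⟨ δ , x ⟩)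

∣χ∣≡1 : (α x : Cube n) → ∣ χ α x ∣ ≡ 1ℚ
∣χ∣≡1 α x with ⟨ α , x ⟩
... | true  = refl
... | false = refl

-- At a `true` bit of `γ` the two halves of the sum are negatives of each other; leading `false`
-- bits are passed over by induction.
∑-χ : (γ : Cube n) → γ ≢ 𝟎 → ∑ (χ γ) ≡ 0ℚ
∑-χ []          γ≢𝟎 = contradiction refl γ≢𝟎
∑-χ (false ∷ γ) γ≢𝟎 = cong₂ _+_ IH IH
  where IH = ∑-χ γ (γ≢𝟎 ∘ cong (false ∷_))
∑-χ (true ∷ γ)  _   = begin
  ∑ (χ γ) + ∑ (χ (true ∷ γ) ∘ (true ∷_))
    ≡⟨ cong (λ s → ∑ (χ γ) + s) (trans
         (∑-cong λ x → trans (sgn-not ⟨ γ , x ⟩) (sym (-1*x≈-x (χ γ x))))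
         (∑-*ˡ (- 1ℚ) (χ γ))) ⟩
  ∑ (χ γ) + - 1ℚ * ∑ (χ γ)
    ≡⟨ solve 1 (λ s → s :+ con (- 1ℚ) :* s := con 0ℚ) refl (∑ (χ γ)) ⟩
  0ℚ ∎
  where open ≡-Reasoning

weight*∑1 : weight n * ∑ {n} (λ _ → 1ℚ) ≡ 1ℚ
weight*∑1 {zero}  = refl
weight*∑1 {suc n} = begin
  weight (suc n) * (s + s)
    ≡⟨ solve 2 (λ w s → w :* (s :+ s) := (w :+ w) :* s) refl (weight (suc n)) s ⟩
  (weight (suc n) + weight (suc n)) * s
    ≡⟨ cong (_* s) (weight-suc n) ⟩
  weight n * s
    ≡⟨ weight*∑1 {n} ⟩
  1ℚ ∎
  where
  open ≡-Reasoning
  s = ∑ {n} (λ _ → 1ℚ)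

-- In the signed sum the half of the cube with the other first bit cancels and the half with first
-- bit `b` is doubled; `weight-suc` absorbs the factor 2.
fourier-suc : (f : Cube (suc n) → ℚ) (b : Bool) (γ : Cube n) →
              fourier f (false ∷ γ) + sgn b * fourier f (true ∷ γ) ≡ fourier (f ∘ (b ∷_)) γ
fourier-suc {n} f b γ = begin
  w * (S₀ + S₁) + sgn b * (w * (S₀ + ∑ (λ x → f (true ∷ x) * χ (true ∷ γ) (true ∷ x))))
    ≡⟨ cong (λ s → w * (S₀ + S₁) + sgn b * (w * (S₀ + s))) flipped ⟩
  w * (S₀ + S₁) + sgn b * (w * (S₀ + - 1ℚ * S₁))
    ≡⟨ select b ⟩
  (w + w) * ∑ (λ x → f (b ∷ x) * χ γ x)
    ≡⟨ cong (_* ∑ (λ x → f (b ∷ x) * χ γ x)) (weight-suc n) ⟩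
  fourier (f ∘ (b ∷_)) γ ∎
  where
  open ≡-Reasoning
  w S₀ S₁ : ℚ
  w = weight (suc n)
  S₀ = ∑ (λ x → f (false ∷ x) * χ γ x)
  S₁ = ∑ (λ x → f (true ∷ x) * χ γ x)
  flipped : ∑ (λ x → f (true ∷ x) * χ (true ∷ γ) (true ∷ x)) ≡ - 1ℚ * S₁
  flipped = trans
    (∑-cong λ x → trans (cong (f (true ∷ x) *_) (sgn-not ⟨ γ , x ⟩))
      (solve 2 (λ a c → a :* :- c := con (- 1ℚ) :* (a :* c)) refl (f (true ∷ x)) (χ γ x)))
    (∑-*ˡ (- 1ℚ) (λ x → f (true ∷ x) * χ γ x))
  select : ∀ b → w * (S₀ + S₁) + sgn b * (w * (S₀ + - 1ℚ * S₁)) ≡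
                 (w + w) * ∑ (λ x → f (b ∷ x) * χ γ x)
  select false = solve 3 (λ w s t → w :* (s :+ t) :+ con 1ℚ :* (w :* (s :+ con (- 1ℚ) :* t))
                                    := (w :+ w) :* s) refl w S₀ S₁
  select true  = solve 3 (λ w s t → w :* (s :+ t) :+ con (- 1ℚ) :* (w :* (s :+ con (- 1ℚ) :* t))
                                    := (w :+ w) :* t) refl w S₀ S₁

-- Induction on the dimension: at `b ∷ x`, summing over the first bit of the frequency collapses by
-- `fourier-suc` to the inversion formula for `f ∘ (b ∷_)` at `x`.
fourier-inversion : (f : Cube n → ℚ) (x : Cube n) → ∑ (λ γ → fourier f γ * χ γ x) ≡ f x
fourier-inversion f []      = solve 1 (λ a → con 1ℚ :* (a :* con 1ℚ) :* con 1ℚ := a) refl (f [])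
fourier-inversion f (b ∷ x) = begin
  ∑ (λ γ → fourier f (false ∷ γ) * χ γ x) +
  ∑ (λ γ → fourier f (true ∷ γ) * χ (true ∷ γ) (b ∷ x))
    ≡⟨ ∑-+ (λ γ → fourier f (false ∷ γ) * χ γ x) (λ γ → fourier f (true ∷ γ) * χ (true ∷ γ) (b ∷ x)) ⟨
  ∑ (λ γ → fourier f (false ∷ γ) * χ γ x + fourier f (true ∷ γ) * χ (true ∷ γ) (b ∷ x))
    ≡⟨ ∑-cong (λ γ → trans (collect γ) (cong (_* χ γ x) (fourier-suc f b γ))) ⟩
  ∑ (λ γ → fourier (f ∘ (b ∷_)) γ * χ γ x)
    ≡⟨ fourier-inversion (f ∘ (b ∷_)) x ⟩
  f (b ∷ x) ∎
  where
  open ≡-Reasoning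
  collect : ∀ γ → fourier f (false ∷ γ) * χ γ x + fourier f (true ∷ γ) * χ (true ∷ γ) (b ∷ x) ≡
                  (fourier f (false ∷ γ) + sgn b * fourier f (true ∷ γ)) * χ γ x
  collect γ = trans
    (cong (λ c → fourier f (false ∷ γ) * χ γ x + fourier f (true ∷ γ) * c) (sgn-xor b ⟨ γ , x ⟩))
    (solve 4 (λ p q s c → p :* c :+ q :* (s :* c) := (p :+ s :* q) :* c) refl
      (fourier f (false ∷ γ)) (fourier f (true ∷ γ)) (sgn b) (χ γ x))

-- Expand one of the two factors by Fourier inversion.
fourier-* : (f g : Cube n → ℚ) (δ : Cube n) →
            ∑ (λ γ → fourier f γ * fourier g (γ ⊕ δ)) ≡ fourier (λ x → f x * g x) δ
fourier-* {n} f g δ = begin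
  ∑ (λ γ → fourier f γ * (w * ∑ (λ x → g x * χ (γ ⊕ δ) x)))
    ≡⟨ ∑-cong (λ γ → trans
         (solve 3 (λ a w s → a :* (w :* s) := w :* (a :* s)) refl (fourier f γ) w _)
         (cong (w *_) (sym (∑-*ˡ (fourier f γ) (λ x → g x * χ (γ ⊕ δ) x))))) ⟩
  ∑ (λ γ → w * ∑ (λ x → fourier f γ * (g x * χ (γ ⊕ δ) x)))
    ≡⟨ ∑-*ˡ w (λ γ → ∑ (λ x → fourier f γ * (g x * χ (γ ⊕ δ) x))) ⟩
  w * ∑ (λ γ → ∑ (λ x → fourier f γ * (g x * χ (γ ⊕ δ) x)))
    ≡⟨ cong (w *_) (∑-swap (λ γ x → fourier f γ * (g x * χ (γ ⊕ δ) x))) ⟩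
  w * ∑ (λ x → ∑ (λ γ → fourier f γ * (g x * χ (γ ⊕ δ) x)))
    ≡⟨ cong (w *_) (∑-cong inner) ⟩
  fourier (λ x → f x * g x) δ ∎
  where
  open ≡-Reasoning
  w = weight n
  inner : ∀ x → ∑ (λ γ → fourier f γ * (g x * χ (γ ⊕ δ) x)) ≡ f x * g x * χ δ x
  inner x = begin
    ∑ (λ γ → fourier f γ * (g x * χ (γ ⊕ δ) x))
      ≡⟨ ∑-cong (λ γ → trans (cong (λ c → fourier f γ * (g x * c)) (χ-⊕ γ δ x))
           (solve 4 (λ a g c d → a :* (g :* (c :* d)) := (a :* c) :* (g :* d)) refl
             (fourier f γ) (g x) (χ γ x) (χ δ x))) ⟩
    ∑ (λ γ → fourier f γ * χ γ x * (g x * χ δ x))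
      ≡⟨ ∑-*ʳ (λ γ → fourier f γ * χ γ x) (g x * χ δ x) ⟩
    ∑ (λ γ → fourier f γ * χ γ x) * (g x * χ δ x)
      ≡⟨ cong (_* (g x * χ δ x)) (fourier-inversion f x) ⟩
    f x * (g x * χ δ x)
      ≡⟨ *-assoc (f x) (g x) (χ δ x) ⟨
    f x * g x * χ δ x ∎

-- The triangle inequality in the inversion formula. It forces a spectral norm of at least 1 once a
-- Boolean function takes the value `true`.
∣f∣≤spectralNorm : (f : Cube n → ℚ) (x : Cube n) → ∣ f x ∣ ≤ spectralNorm f
∣f∣≤spectralNorm f x = begin
  ∣ f x ∣                              ≡⟨ cong ∣_∣ (fourier-inversion f x) ⟨
  ∣ ∑ (λ γ → fourier f γ * χ γ x) ∣    ≤⟨ ∣∑∣≤∑∣∣ (λ γ → fourier f γ * χ γ x) ⟩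
  ∑ (λ γ → ∣ fourier f γ * χ γ x ∣)    ≡⟨ ∑-cong (λ γ → begin-equality
    ∣ fourier f γ * χ γ x ∣       ≡⟨ ∣p*q∣≡∣p∣*∣q∣ (fourier f γ) (χ γ x) ⟩
    ∣ fourier f γ ∣ * ∣ χ γ x ∣   ≡⟨ cong (∣ fourier f γ ∣ *_) (∣χ∣≡1 γ x) ⟩
    ∣ fourier f γ ∣ * 1ℚ          ≡⟨ *-identityʳ ∣ fourier f γ ∣ ⟩
    ∣ fourier f γ ∣               ∎) ⟩
  spectralNorm f                       ∎
  where open ≤-Reasoning

weight-nonNeg : ∀ n → 0ℚ ≤ weight n
weight-nonNeg n = nonNegative⁻¹ (weight n) {{normalize-nonNeg 1 (2 ℕ.^ n) {{ℕ.m^n≢0 2 n}}}}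

∣fourier∣≤fourier𝟎 : (f : Cube n → ℚ) → (∀ x → 0ℚ ≤ f x) → (γ : Cube n) → ∣ fourier f γ ∣ ≤ fourier f 𝟎
∣fourier∣≤fourier𝟎 {n} f 0≤f γ = begin
  ∣ w * ∑ (λ x → f x * χ γ x) ∣
    ≡⟨ trans (∣p*q∣≡∣p∣*∣q∣ w (∑ (λ x → f x * χ γ x)))
         (cong (_* ∣ ∑ (λ x → f x * χ γ x) ∣) (0≤p⇒∣p∣≡p (weight-nonNeg n))) ⟩
  w * ∣ ∑ (λ x → f x * χ γ x) ∣
    ≤⟨ *-monoˡ-≤-nonNeg w {{nonNegative (weight-nonNeg n)}} (∣∑∣≤∑∣∣ (λ x → f x * χ γ x)) ⟩
  w * ∑ (λ x → ∣ f x * χ γ x ∣)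
    ≡⟨ cong (w *_) (∑-cong λ x → begin-equality
         ∣ f x * χ γ x ∣      ≡⟨ ∣p*q∣≡∣p∣*∣q∣ (f x) (χ γ x) ⟩
         ∣ f x ∣ * ∣ χ γ x ∣  ≡⟨ cong₂ _*_ (0≤p⇒∣p∣≡p (0≤f x)) (∣χ∣≡1 γ x) ⟩
         f x * 1ℚ             ≡⟨ cong (λ b → f x * sgn b) (⟨𝟎,-⟩ x) ⟨
         f x * χ 𝟎 x          ∎) ⟩
  fourier f 𝟎 ∎
  where
  open ≤-Reasoning
  w = weight n

-- Linear and affine embeddings of cubes

⊕-assoc : (x y z : Cube n) → (x ⊕ y) ⊕ z ≡ x ⊕ (y ⊕ z)
⊕-assoc = zipWith-assoc 𝔽₂.+-assoc

⊕-self : (x : Cube n) → x ⊕ x ≡ 𝟎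
⊕-self []      = refl
⊕-self (b ∷ x) = cong₂ _∷_ (xor-same b) (⊕-self x)

⊕-cancelʳ : (x y : Cube n) → (x ⊕ y) ⊕ y ≡ x
⊕-cancelʳ x y = trans (⊕-assoc x y y) (trans (cong (x ⊕_) (⊕-self y)) (⊕-identityʳ x))

true-· : (x : Cube n) → true · x ≡ x
true-· = map-id

false-· : (x : Cube n) → false · x ≡ 𝟎
false-· x = map-const x false

·-𝟎 : (c : Bool) → c · 𝟎 {n} ≡ 𝟎
·-𝟎 true  = true-· 𝟎
·-𝟎 false = false-· 𝟎

-- Injectivity is encoded as triviality of the kernel. Compatibility with scalars follows from
-- additivity in `to-·`, as the only scalars are 0 and 1.
record LinearEmbedding (d n : ℕ) : Set where
  field
    to        : Cube d → Cube n
    to-⊕      : ∀ x y → to (x ⊕ y) ≡ to x ⊕ to y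
    injective : ∀ {x} → to x ≡ 𝟎 → x ≡ 𝟎

  to-𝟎 : to 𝟎 ≡ 𝟎
  to-𝟎 = begin
    to 𝟎                  ≡⟨ ⊕-cancelʳ (to 𝟎) (to 𝟎) ⟨
    (to 𝟎 ⊕ to 𝟎) ⊕ to 𝟎  ≡⟨ cong (_⊕ to 𝟎) (trans (sym (to-⊕ 𝟎 𝟎)) (cong to (⊕-self 𝟎))) ⟩
    to 𝟎 ⊕ to 𝟎           ≡⟨ ⊕-self (to 𝟎) ⟩
    𝟎                     ∎
    where open ≡-Reasoning

  to-· : ∀ c x → to (c · x) ≡ c · to x
  to-· true  x = trans (cong to (true-· x)) (sym (true-· (to x)))
  to-· false x = trans (cong to (false-· x)) (trans to-𝟎 (sym (false-· (to x))))

  linComb-to : (cs : Vec Bool k) (vs : Vec (Cube d) k) →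
               linComb cs (map to vs) ≡ to (linComb cs vs)
  linComb-to []       []       = sym to-𝟎
  linComb-to (c ∷ cs) (v ∷ vs) = trans
    (cong₂ _⊕_ (sym (to-· c v)) (linComb-to cs vs))
    (sym (to-⊕ (c · v) (linComb cs vs)))

open LinearEmbedding

idₗ : LinearEmbedding n n
idₗ = record { to = id ; to-⊕ = λ _ _ → refl ; injective = id }

consₗ : LinearEmbedding m n → LinearEmbedding (suc m) (suc n)
consₗ L = record
  { to        = λ { (b ∷ x) → b ∷ to L x }
  ; to-⊕      = λ { (b ∷ x) (c ∷ y) → cong (_ ∷_) (to-⊕ L x y) }
  ; injective = λ { {b ∷ x} eq → cong₂ _∷_ (∷-injectiveˡ eq) (injective L (∷-injectiveʳ eq)) }
  }

_∘ₗ_ : LinearEmbedding m n → LinearEmbedding d m → LinearEmbedding d n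
L ∘ₗ L′ = record
  { to        = to L ∘ to L′
  ; to-⊕      = λ x y → trans (cong (to L) (to-⊕ L′ x y)) (to-⊕ L _ _)
  ; injective = injective L′ ∘ injective L
  }

false∷ₗ : LinearEmbedding n (suc n)
false∷ₗ = record { to = false ∷_ ; to-⊕ = λ _ _ → refl ; injective = ∷-injectiveʳ }

standardBasis : ∀ n → Vec (Cube n) n
standardBasis zero    = []
standardBasis (suc n) = (true ∷ 𝟎) ∷ map (false ∷_) (standardBasis n)

linComb-standardBasis : (cs : Vec Bool n) → linComb cs (standardBasis n) ≡ cs
linComb-standardBasis []       = refl
linComb-standardBasis {suc n} (c ∷ cs) = begin
  (c · (true ∷ 𝟎)) ⊕ linComb cs (map (false ∷_) (standardBasis n))
    ≡⟨ cong (c · (true ∷ 𝟎) ⊕_) (trans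
         (linComb-to false∷ₗ cs (standardBasis n))
         (cong (false ∷_) (linComb-standardBasis cs))) ⟩
  ((c ∧ true) xor false) ∷ (c · 𝟎 ⊕ cs)
    ≡⟨ cong₂ _∷_
         (trans (𝔽₂.+-identityʳ (c ∧ true)) (∧-identityʳ c))
         (trans (cong (_⊕ cs) (·-𝟎 c)) (⊕-identityˡ cs)) ⟩
  c ∷ cs ∎
  where open ≡-Reasoning

-- Affine subspaces are handled through parametrisations by smaller cubes, so that a restricted
-- function again lives on a cube and the induction can continue.
record AffineEmbedding (d n : ℕ) : Set where
  field
    offset : Cube n
    linear : LinearEmbedding d n

  ⟦_⟧ : Cube d → Cube n
  ⟦ y ⟧ = offset ⊕ to linear y

open AffineEmbedding

idₐ : AffineEmbedding n n
idₐ = record { offset = 𝟎 ; linear = idₗ }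

_∘ₐ_ : AffineEmbedding m n → AffineEmbedding d m → AffineEmbedding d n
φ ∘ₐ ψ = record { offset = ⟦ φ ⟧ (offset ψ) ; linear = linear φ ∘ₗ linear ψ }

⟦∘ₐ⟧ : (φ : AffineEmbedding m n) (ψ : AffineEmbedding d m) (y : Cube d) →
       ⟦ φ ∘ₐ ψ ⟧ y ≡ ⟦ φ ⟧ (⟦ ψ ⟧ y)
⟦∘ₐ⟧ φ ψ y = trans (⊕-assoc (offset φ) _ _)
  (cong (offset φ ⊕_) (sym (to-⊕ (linear φ) (offset ψ) (to (linear ψ) y))))

range : LinearEmbedding d n → Subspace n
range L = record
  { member   = λ x → ∃[ y ] to L y ≡ x
  ; 𝟎-closed = 𝟎 , to-𝟎 L
  ; ⊕-closed = λ { (y , refl) (z , refl) → y ⊕ z , to-⊕ L y z }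
  ; ·-closed = λ { c (y , refl) → c · y , to-· L c y }
  }

-- In the images of the standard basis, the combination with coefficients `cs` is `to L cs`;
-- independence is then injectivity of `L`, and spanning is the definition of the range.
range-dimension : (L : LinearEmbedding d n) → HasDimension (range L) d
range-dimension {d} L = map (to L) (standardBasis d) , record
  { members     = map⁺ (universal (λ y → y , refl) (standardBasis d))
  ; independent = λ cs eq → injective L (trans (sym (linComb-basis cs)) eq)
  ; spanning    = λ { (y , eq) → y , trans (linComb-basis y) eq }
  }
  where
  linComb-basis : ∀ cs → linComb cs (map (to L) (standardBasis d)) ≡ to L cs
  linComb-basis cs = trans (linComb-to L cs (standardBasis d)) (cong (to L) (linComb-standardBasis cs))

image : AffineEmbedding d n → AffineSubspace n
image φ = record { base = offset φ ; direction = range (linear φ) }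

-- Parallel parametrisations of the two hyperplanes ⟨ α , x ⟩ ≡ b, together with
-- a section lift of the dual map, whose fibres are the pairs {γ , γ ⊕ α}.
record HyperplaneChart (α : Cube (suc n)) : Set where
  field
    chartOffset : Bool → Cube (suc n)
    chartLinear : LinearEmbedding n (suc n)

  chart : Bool → AffineEmbedding n (suc n)
  chart b = record { offset = chartOffset b ; linear = chartLinear }

  field
    lift      : Cube n → Cube (suc n)
    ∑-chart   : (F : Cube (suc n) → ℚ) →
                ∑ F ≡ ∑ (λ y → F (⟦ chart false ⟧ y)) + ∑ (λ y → F (⟦ chart true ⟧ y))
    ∑-lift    : (F : Cube (suc n) → ℚ) →
                ∑ F ≡ ∑ (λ β → F (lift β)) + ∑ (λ β → F (lift β ⊕ α))
    ⟨α,chart⟩ : ∀ b y → ⟨ α , ⟦ chart b ⟧ y ⟩ ≡ b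
    ⟨lift,chart⟩ : ∀ b β y → ⟨ lift β , ⟦ chart b ⟧ y ⟩ ≡ ⟨ β , y ⟩
    lift-𝟎    : lift 𝟎 ≡ 𝟎
    lift-injective : ∀ {β} → lift β ≡ 𝟎 → β ≡ 𝟎
    lift⊕α≢𝟎  : ∀ β → lift β ⊕ α ≢ 𝟎

-- The hyperplane through `𝟎` with normal vector `true ∷ α`, its first coordinate solved for in
-- terms of the others.
graphₗ : Cube n → LinearEmbedding n (suc n)
graphₗ α = record
  { to        = λ y → ⟨ α , y ⟩ ∷ y
  ; to-⊕      = λ x y → cong (_∷ (x ⊕ y)) (⟨⟩-⊕ʳ α x y)
  ; injective = ∷-injectiveʳ
  }

-- The first `true` bit of `α` serves as pivot: its coordinate is solved for in the charts and set
-- to `false` in the lifts. The coordinates before it are copied unchanged.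
hyperplaneChart : (α : Cube (suc n)) → α ≢ 𝟎 → HyperplaneChart α
hyperplaneChart (true ∷ α) _ = record
  { chartOffset    = _∷ 𝟎
  ; chartLinear    = graphₗ α
  ; lift           = false ∷_
  ; ∑-chart        = λ F → trans
      (sym (∑-+ (λ y → F (false ∷ y)) (λ y → F (true ∷ y))))
      (trans (∑-cong λ y → split F ⟨ α , y ⟩ y)
        (∑-+ (λ y → F (⟨ α , y ⟩ ∷ (𝟎 ⊕ y))) (λ y → F (not ⟨ α , y ⟩ ∷ (𝟎 ⊕ y)))))
  -- Adding `true ∷ α` flips the pivot and translates the remaining bits by `α`; `∑-shift` undoes
  -- the translation.
  ; ∑-lift         = λ F → cong (λ s → ∑ (F ∘ (false ∷_)) + s) (sym (∑-shift (F ∘ (true ∷_)) α))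
  ; ⟨α,chart⟩      = λ b y → trans
      (cong (λ z → (b xor ⟨ α , y ⟩) xor ⟨ α , z ⟩) (⊕-identityˡ y))
      (trans (𝔽₂.+-assoc b _ _) (trans (cong (b xor_) (xor-same ⟨ α , y ⟩)) (𝔽₂.+-identityʳ b)))
  ; ⟨lift,chart⟩   = λ b β y → cong ⟨ β ,_⟩ (⊕-identityˡ y)
  ; lift-𝟎         = refl
  ; lift-injective = ∷-injectiveʳ
  ; lift⊕α≢𝟎       = λ _ ()
  }
  where
  -- The two chart points over `y` are `false ∷ y` and `true ∷ y`, in an order decided by
  -- `⟨ α , y ⟩`.
  split : (F : Cube _ → ℚ) (c : Bool) (y : Cube _) →
          F (false ∷ y) + F (true ∷ y) ≡ F (c ∷ (𝟎 ⊕ y)) + F (not c ∷ (𝟎 ⊕ y))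
  split F false y = cong (λ z → F (false ∷ z) + F (true ∷ z)) (sym (⊕-identityˡ y))
  split F true  y = trans (split F false y) (+-comm (F (false ∷ (𝟎 ⊕ y))) (F (true ∷ (𝟎 ⊕ y))))
hyperplaneChart {zero}  (false ∷ []) α≢𝟎 = contradiction refl α≢𝟎
hyperplaneChart {suc n} (false ∷ α)  α≢𝟎 = record
  { chartOffset    = λ b → false ∷ chartOffset b
  ; chartLinear    = consₗ chartLinear
  ; lift           = λ { (b ∷ β) → b ∷ lift β }
  ; ∑-chart        = λ F → trans
      (cong₂ _+_ (∑-chart (F ∘ (false ∷_))) (∑-chart (F ∘ (true ∷_))))
      (+-interchange (∑ (λ y → F (false ∷ ⟦ chart false ⟧ y))) (∑ (λ y → F (false ∷ ⟦ chart true ⟧ y))) _ _)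
  ; ∑-lift         = λ F → trans
      (cong₂ _+_ (∑-lift (F ∘ (false ∷_))) (∑-lift (F ∘ (true ∷_))))
      (+-interchange (∑ (λ β → F (false ∷ lift β))) (∑ (λ β → F (false ∷ (lift β ⊕ α)))) _ _)
  ; ⟨α,chart⟩      = λ { b (_ ∷ y) → ⟨α,chart⟩ b y }
  ; ⟨lift,chart⟩   = λ { b (c ∷ β) (e ∷ y) → cong ((c ∧ e) xor_) (⟨lift,chart⟩ b β y) }
  ; lift-𝟎         = cong (false ∷_) lift-𝟎
  ; lift-injective = λ { {b ∷ β} eq → cong₂ _∷_ (∷-injectiveˡ eq) (lift-injective (∷-injectiveʳ eq)) }
  ; lift⊕α≢𝟎       = λ { (b ∷ β) eq → lift⊕α≢𝟎 β (∷-injectiveʳ eq) }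
  }
  where
  chart-α : HyperplaneChart α
  chart-α = hyperplaneChart α (α≢𝟎 ∘ cong (false ∷_))
  open HyperplaneChart chart-α

module _ {α : Cube (suc n)} (H : HyperplaneChart α) where
  open HyperplaneChart H

  -- On the chosen hyperplane `χ α` is constantly `sgn b`, so `χ (lift β)` and `χ (lift β ⊕ α)`
  -- restrict to `χ β` and `sgn b * χ β`. In the signed sum the other hyperplane cancels and this
  -- one counts twice, as in `fourier-suc`.
  fourier-chart : (f : Cube (suc n) → ℚ) (b : Bool) (β : Cube n) →
    fourier (λ y → f (⟦ chart b ⟧ y)) β ≡ fourier f (lift β) + sgn b * fourier f (lift β ⊕ α)
  fourier-chart f b β = sym (begin
    w * ∑ (λ x → f x * χ (lift β) x) + sgn b * (w * ∑ (λ x → f x * χ (lift β ⊕ α) x))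
      ≡⟨ cong₂ (λ s t → w * s + sgn b * (w * t))
           (trans (∑-chart (λ x → f x * χ (lift β) x)) (cong₂ _+_ (S-lift false) (S-lift true)))
           (trans (∑-chart (λ x → f x * χ (lift β ⊕ α) x)) (cong₂ _+_ (S-lift⊕α false) (S-lift⊕α true))) ⟩
    w * (S false + S true) + sgn b * (w * (1ℚ * S false + - 1ℚ * S true))
      ≡⟨ select b ⟩
    (w + w) * S b
      ≡⟨ cong (_* S b) (weight-suc n) ⟩
    weight n * S b ∎)
    where
    open ≡-Reasoning
    w = weight (suc n)
    S : Bool → ℚ
    S c = ∑ (λ y → f (⟦ chart c ⟧ y) * χ β y)
    S-lift : ∀ c → ∑ (λ y → f (⟦ chart c ⟧ y) * χ (lift β) (⟦ chart c ⟧ y)) ≡ S c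
    S-lift c = ∑-cong λ y → cong (λ e → f (⟦ chart c ⟧ y) * sgn e) (⟨lift,chart⟩ c β y)
    S-lift⊕α : ∀ c → ∑ (λ y → f (⟦ chart c ⟧ y) * χ (lift β ⊕ α) (⟦ chart c ⟧ y)) ≡ sgn c * S c
    S-lift⊕α c = trans
      (∑-cong λ y → begin
        f (⟦ chart c ⟧ y) * χ (lift β ⊕ α) (⟦ chart c ⟧ y)
          ≡⟨ cong (f (⟦ chart c ⟧ y) *_) (χ-⊕ (lift β) α (⟦ chart c ⟧ y)) ⟩
        f (⟦ chart c ⟧ y) * (χ (lift β) (⟦ chart c ⟧ y) * χ α (⟦ chart c ⟧ y))
          ≡⟨ cong₂ (λ e e′ → f (⟦ chart c ⟧ y) * (sgn e * sgn e′)) (⟨lift,chart⟩ c β y) (⟨α,chart⟩ c y) ⟩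
        f (⟦ chart c ⟧ y) * (χ β y * sgn c)
          ≡⟨ solve 3 (λ a x s → a :* (x :* s) := s :* (a :* x)) refl (f (⟦ chart c ⟧ y)) (χ β y) (sgn c) ⟩
        sgn c * (f (⟦ chart c ⟧ y) * χ β y) ∎)
      (∑-*ˡ (sgn c) (λ y → f (⟦ chart c ⟧ y) * χ β y))
    select : ∀ b → w * (S false + S true) + sgn b * (w * (1ℚ * S false + - 1ℚ * S true)) ≡ (w + w) * S b
    select false = solve 3 (λ w s t → w :* (s :+ t) :+ con 1ℚ :* (w :* (con 1ℚ :* s :+ con (- 1ℚ) :* t))
                                      := (w :+ w) :* s) refl w (S false) (S true)
    select true  = solve 3 (λ w s t → w :* (s :+ t) :+ con (- 1ℚ) :* (w :* (con 1ℚ :* s :+ con (- 1ℚ) :* t))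
                                      := (w :+ w) :* t) refl w (S false) (S true)

-- Inequalities

+-nonNeg : ∀ {p q} → 0ℚ ≤ p → 0ℚ ≤ q → 0ℚ ≤ p + q
+-nonNeg = +-mono-≤

*-nonNeg : ∀ {p q} → 0ℚ ≤ p → 0ℚ ≤ q → 0ℚ ≤ p * q
*-nonNeg {p} {q} 0≤p 0≤q = ≤-trans (≤-reflexive (sym (*-zeroʳ p)))
  (*-monoˡ-≤-nonNeg p {{nonNegative 0≤p}} 0≤q)

≤⇒0≤- : ∀ {p q} → p ≤ q → 0ℚ ≤ q + - p
≤⇒0≤- {p} p≤q = ≤-trans (≤-reflexive (sym (+-inverseʳ p))) (+-monoˡ-≤ (- p) p≤q)

-- The certificate form of the polynomial inequalities below: the gap `r` is visibly nonnegative,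
-- and the equation is left to the ring solver.
≤-by : ∀ {p q r} → 0ℚ ≤ r → q ≡ p + r → p ≤ q
≤-by {p} 0≤r refl = ≤-trans (≤-reflexive (sym (+-identityʳ p))) (+-monoʳ-≤ p 0≤r)

∣∣-lub : ∀ {p q} → p ≤ q → - p ≤ q → ∣ p ∣ ≤ q
∣∣-lub {p} p≤q -p≤q with ∣p∣≡p∨∣p∣≡-p p
... | inj₁ ∣p∣≡p  = ≤-trans (≤-reflexive ∣p∣≡p) p≤q
... | inj₂ ∣p∣≡-p = ≤-trans (≤-reflexive ∣p∣≡-p) -p≤q

p≡±∣p∣ : ∀ p → p ≡ ∣ p ∣ ⊎ p ≡ - ∣ p ∣
p≡±∣p∣ p with ∣p∣≡p∨∣p∣≡-p p
... | inj₁ ∣p∣≡p  = inj₁ (sym ∣p∣≡p)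
... | inj₂ ∣p∣≡-p = inj₂ (trans (sym (-‿involutive p)) (cong -_ (sym ∣p∣≡-p)))

∣p∣∣p∣≡pp : ∀ p → ∣ p ∣ * ∣ p ∣ ≡ p * p
∣p∣∣p∣≡pp p with ∣p∣≡p∨∣p∣≡-p p
... | inj₁ ∣p∣≡p  = cong₂ _*_ ∣p∣≡p ∣p∣≡p
... | inj₂ ∣p∣≡-p = trans (cong₂ _*_ ∣p∣≡-p ∣p∣≡-p) (solve 1 (λ p → :- p :* :- p := p :* p) refl p)

≤-scaled : ∀ {M s t u w} → u ≡ s ⊎ u ≡ - s → w ≡ t ⊎ w ≡ - t →
           0ℚ ≤ s → 0ℚ ≤ t → s ≤ M → t ≤ M →
           M * (u + w) ≤ M * (s + t) + (u * w + u * w)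
≤-scaled {M} {s} {t} (inj₁ refl) (inj₁ refl) 0≤s 0≤t s≤M t≤M =
  ≤-by (+-nonNeg (*-nonNeg 0≤s 0≤t) (*-nonNeg 0≤s 0≤t)) refl
≤-scaled {M} {s} {t} (inj₁ refl) (inj₂ refl) 0≤s 0≤t s≤M t≤M =
  ≤-by (+-nonNeg r r)
    (solve 3 (λ M s t → M :* (s :+ t) :+ (s :* :- t :+ s :* :- t)
       := M :* (s :+ :- t) :+ (t :* (M :+ :- s) :+ t :* (M :+ :- s))) refl M s t)
  where r = *-nonNeg 0≤t (≤⇒0≤- s≤M)
≤-scaled {M} {s} {t} (inj₂ refl) (inj₁ refl) 0≤s 0≤t s≤M t≤M =
  ≤-by (+-nonNeg r r)
    (solve 3 (λ M s t → M :* (s :+ t) :+ (:- s :* t :+ :- s :* t)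
       := M :* (:- s :+ t) :+ (s :* (M :+ :- t) :+ s :* (M :+ :- t))) refl M s t)
  where r = *-nonNeg 0≤s (≤⇒0≤- t≤M)
≤-scaled {M} {s} {t} (inj₂ refl) (inj₂ refl) 0≤s 0≤t s≤M t≤M =
  ≤-by (+-nonNeg r r)
    (solve 3 (λ M s t → M :* (s :+ t) :+ (:- s :* :- t :+ :- s :* :- t)
       := M :* (:- s :+ :- t) :+ ((M :* (s :+ t) :+ s :* t) :+ (M :* (s :+ t) :+ s :* t))) refl M s t)
  where r = +-nonNeg (*-nonNeg (≤-trans 0≤s s≤M) (+-nonNeg 0≤s 0≤t)) (*-nonNeg 0≤s 0≤t)

-- Measures the cancellation within a pair. For opposite signs, ∣u∣ + ∣w∣ - ∣u + w∣ is twice the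
-- smaller modulus, and `M` bounds the larger one, so `M` times this loss is at least -2uw. For
-- equal signs nothing is lost and uw ≥ 0.
scaled-∣+∣ : ∀ {M u w} → ∣ u ∣ ≤ M → ∣ w ∣ ≤ M →
             M * ∣ u + w ∣ ≤ M * (∣ u ∣ + ∣ w ∣) + (u * w + u * w)
scaled-∣+∣ {M} {u} {w} ∣u∣≤M ∣w∣≤M with ∣p∣≡p∨∣p∣≡-p (u + w)
... | inj₁ eq = ≤-trans (≤-reflexive (cong (M *_) eq))
  (≤-scaled (p≡±∣p∣ u) (p≡±∣p∣ w) (0≤∣p∣ u) (0≤∣p∣ w) ∣u∣≤M ∣w∣≤M)
... | inj₂ eq = begin
  M * ∣ u + w ∣
    ≡⟨ cong (M *_) (trans eq (neg-distrib-+ u w)) ⟩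
  M * (- u + - w)
    ≤⟨ ≤-scaled (neg± u) (neg± w) (0≤∣p∣ u) (0≤∣p∣ w) ∣u∣≤M ∣w∣≤M ⟩
  M * (∣ u ∣ + ∣ w ∣) + (- u * - w + - u * - w)
    ≡⟨ cong (λ e → M * (∣ u ∣ + ∣ w ∣) + (e + e)) (solve 2 (λ u w → :- u :* :- w := u :* w) refl u w) ⟩
  M * (∣ u ∣ + ∣ w ∣) + (u * w + u * w) ∎
  where
  open ≤-Reasoning
  neg± : ∀ p → - p ≡ ∣ p ∣ ⊎ - p ≡ - ∣ p ∣
  neg± p with ∣p∣≡p∨∣p∣≡-p p
  ... | inj₁ ∣p∣≡p  = inj₂ (cong -_ (sym ∣p∣≡p))
  ... | inj₂ ∣p∣≡-p = inj₁ (sym ∣p∣≡-p)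

-- D = 1 - 2p + 2M is the amount by which the restriction lowers the norm.
norm²-drop : ∀ {p M A A′} → 0ℚ < p → p + p ≤ 1ℚ → 0ℚ ≤ M → 1ℚ ≤ A → 0ℚ ≤ A′ →
             p ≤ M * A + (p * p + - (M * p)) →
             M * A′ ≤ M * A + - M + ((p + p) * M + - (M + M) * M) →
             1ℚ + A′ * A′ ≤ A * A
norm²-drop {p} {M} {A} {A′} 0<p 2p≤1 0≤M 1≤A 0≤A′ parseval drop = begin
  1ℚ + A′ * A′               ≤⟨ +-monoʳ-≤ 1ℚ A′²≤ ⟩
  1ℚ + (A + - D) * (A + - D) ≤⟨ by-size (≤-total D 1ℚ) ⟩
  A * A                      ∎
  where
  open ≤-Reasoning
  D = 1ℚ + - (p + p) + (M + M)
  -- Nonnegativity of `E` is the inequality D (2A - 1) ≥ 1.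
  E = D * (A + A + - 1ℚ) + - 1ℚ

  p<A : p < A
  p<A = <-≤-trans p<1 1≤A
    where
    p<1 : p < 1ℚ
    p<1 = <-≤-trans (≤-<-trans (≤-reflexive (sym (+-identityʳ p))) (+-monoʳ-< p 0<p)) 2p≤1

  0<A-p : 0ℚ < A + - p
  0<A-p = ≤-<-trans (≤-reflexive (sym (+-inverseʳ p))) (+-monoˡ-< (- p) p<A)

  -- For M ≤ 0 the Parseval bound would give p (1 - p) ≤ M (A - p) ≤ 0, against 0 < p < 1.
  M≢0 : ¬ (M ≤ 0ℚ)
  M≢0 M≤0 = <-irrefl refl (<-≤-trans 0<p[1-p] p[1-p]≤0)
    where
    0<p[1-p] : 0ℚ < p * (1ℚ + - p)
    0<p[1-p] = positive⁻¹ (p * (1ℚ + - p)) {{pos*pos⇒pos p {{positive 0<p}} (1ℚ + - p)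
      {{positive (<-≤-trans 0<p (≤-by (≤⇒0≤- 2p≤1)
        (solve 1 (λ p → con 1ℚ :+ :- p := p :+ (con 1ℚ :+ :- (p :+ p))) refl p)))}}}}
    p[1-p]≤0 : p * (1ℚ + - p) ≤ 0ℚ
    p[1-p]≤0 = begin
      p * (1ℚ + - p)
        ≡⟨ solve 1 (λ p → p :* (con 1ℚ :+ :- p) := p :+ :- (p :* p)) refl p ⟩
      p + - (p * p)
        ≤⟨ +-monoˡ-≤ (- (p * p)) parseval ⟩
      M * A + (p * p + - (M * p)) + - (p * p)
        ≡⟨ solve 3 (λ p M A → M :* A :+ (p :* p :+ :- (M :* p)) :+ :- (p :* p)
             := M :* (A :+ :- p)) refl p M A ⟩
      M * (A + - p)
        ≤⟨ *-monoʳ-≤-nonNeg (A + - p) {{nonNegative (<⇒≤ 0<A-p)}} M≤0 ⟩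
      0ℚ * (A + - p)
        ≡⟨ *-zeroˡ (A + - p) ⟩
      0ℚ ∎

  -- `drop` is this inequality multiplied by the positive `M`.
  A′≤A-D : A′ ≤ A + - D
  A′≤A-D = *-cancelˡ-≤-pos M {{positive (≰⇒> M≢0)}} (≤-trans drop (≤-reflexive
    (solve 3 (λ p M A → M :* A :+ :- M :+ ((p :+ p) :* M :+ :- (M :+ M) :* M)
      := M :* (A :+ :- (con 1ℚ :+ :- (p :+ p) :+ (M :+ M)))) refl p M A)))

  A′²≤ : A′ * A′ ≤ (A + - D) * (A + - D)
  A′²≤ = ≤-trans (*-monoˡ-≤-nonNeg A′ {{nonNegative 0≤A′}} A′≤A-D)
    (*-monoʳ-≤-nonNeg (A + - D) {{nonNegative (≤-trans 0≤A′ A′≤A-D)}} A′≤A-D)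

  0≤A : 0ℚ ≤ A
  0≤A = <⇒≤ (<-trans 0<p p<A)

  0≤D : 0ℚ ≤ D
  0≤D = +-nonNeg (≤⇒0≤- 2p≤1) (+-nonNeg 0≤M 0≤M)

  0≤2A-1 : 0ℚ ≤ A + A + - 1ℚ
  0≤2A-1 = ≤-trans (+-nonNeg 0≤A (≤⇒0≤- 1≤A)) (≤-reflexive (sym (+-assoc A A (- 1ℚ))))

  -- With X the nonnegative gap in `parseval`, (A - p) E = 2 (2A - 1) X + 2A (1 - 2p) (A - 1), and A
  -- - p is positive.
  0≤E : 0ℚ ≤ E
  0≤E = *-cancelˡ-≤-pos (A + - p) {{positive 0<A-p}} (≤-trans (≤-reflexive (*-zeroʳ (A + - p)))
    (≤-trans (+-nonNeg (*-nonNeg 0≤2A-1 (+-nonNeg 0≤X 0≤X))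
                       (*-nonNeg (≤⇒0≤- 2p≤1) (*-nonNeg (+-nonNeg 0≤A 0≤A) (≤⇒0≤- 1≤A))))
      (≤-reflexive (solve 3 (λ p M A →
        let X = M :* A :+ (p :* p :+ :- (M :* p)) :+ :- p in
        (A :+ A :+ :- con 1ℚ) :* (X :+ X) :+
        (con 1ℚ :+ :- (p :+ p)) :* ((A :+ A) :* (A :+ :- con 1ℚ))
        := (A :+ :- p) :* ((con 1ℚ :+ :- (p :+ p) :+ (M :+ M)) :* (A :+ A :+ :- con 1ℚ) :+ :- con 1ℚ))
        refl p M A))))
    where 0≤X = ≤⇒0≤- parseval

  -- A² - (A - D)² - 1 equals E + D (1 - D), which settles D ≤ 1, and also (D - 1) A + (A - 1) + D
  -- (A - D), which settles D ≥ 1 because A - D ≥ A′ ≥ 0.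
  by-size : D ≤ 1ℚ ⊎ 1ℚ ≤ D → 1ℚ + (A + - D) * (A + - D) ≤ A * A
  by-size (inj₁ D≤1) = ≤-by (+-nonNeg 0≤E (*-nonNeg 0≤D (≤⇒0≤- D≤1)))
    (solve 2 (λ A D → A :* A := (con 1ℚ :+ (A :+ :- D) :* (A :+ :- D)) :+
      ((D :* (A :+ A :+ :- con 1ℚ) :+ :- con 1ℚ) :+ D :* (con 1ℚ :+ :- D))) refl A D)
  by-size (inj₂ 1≤D) = ≤-by
    (+-nonNeg (+-nonNeg (*-nonNeg (≤⇒0≤- 1≤D) 0≤A) (≤⇒0≤- 1≤A))
              (*-nonNeg 0≤D (≤-trans 0≤A′ A′≤A-D)))
    (solve 2 (λ A D → A :* A := (con 1ℚ :+ (A :+ :- D) :* (A :+ :- D)) :+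
      (((D :+ :- con 1ℚ) :* A :+ (A :+ :- con 1ℚ)) :+ D :* (A :+ :- D))) refl A D)

-- The restriction argument

true-or-all-false : (f : Cube n → Bool) → (∃[ x ] f x ≡ true) ⊎ (∀ x → f x ≡ false)
true-or-all-false {zero} f with f [] in eq
... | true  = inj₁ ([] , eq)
... | false = inj₂ λ { [] → eq }
true-or-all-false {suc n} f with true-or-all-false (f ∘ (false ∷_)) | true-or-all-false (f ∘ (true ∷_))
... | inj₁ (x , fx) | _             = inj₁ (false ∷ x , fx)
... | inj₂ _        | inj₁ (x , fx) = inj₁ (true ∷ x , fx)
... | inj₂ f₀       | inj₂ f₁       = inj₂ λ { (false ∷ x) → f₀ x ; (true ∷ x) → f₁ x }

argmax : (F : Cube n → ℚ) → ∃[ x ] (∀ y → F y ≤ F x)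
argmax {zero}  F = [] , λ { [] → ≤-refl }
argmax {suc n} F with argmax (F ∘ (false ∷_)) | argmax (F ∘ (true ∷_))
... | x₀ , max₀ | x₁ , max₁ with ≤-total (F (false ∷ x₀)) (F (true ∷ x₁))
... | inj₁ le = true ∷ x₁  , λ { (false ∷ y) → ≤-trans (max₀ y) le ; (true ∷ y) → max₁ y }
... | inj₂ ge = false ∷ x₀ , λ { (false ∷ y) → max₀ y ; (true ∷ y) → ≤-trans (max₁ y) ge }

argmax-≢𝟎 : (F : Cube (suc n) → ℚ) → ∃[ x ] (x ≢ 𝟎 × ∀ y → y ≢ 𝟎 → F y ≤ F x)
argmax-≢𝟎 {zero} F = true ∷ [] , (λ ()) , λ
  { (false ∷ []) y≢𝟎 → contradiction refl y≢𝟎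
  ; (true ∷ [])  _   → ≤-refl }
argmax-≢𝟎 {suc n} F with argmax-≢𝟎 (F ∘ (false ∷_)) | argmax (F ∘ (true ∷_))
... | x₀ , x₀≢𝟎 , max₀ | x₁ , max₁ with ≤-total (F (false ∷ x₀)) (F (true ∷ x₁))
... | inj₁ le = true ∷ x₁ , (λ ()) , λ
  { (false ∷ y) y≢𝟎 → ≤-trans (max₀ y (y≢𝟎 ∘ cong (false ∷_))) le
  ; (true ∷ y)  _   → max₁ y }
... | inj₂ ge = false ∷ x₀ , x₀≢𝟎 ∘ ∷-injectiveʳ , λ
  { (false ∷ y) y≢𝟎 → max₀ y (y≢𝟎 ∘ cong (false ∷_))
  ; (true ∷ y)  _   → ≤-trans (max₁ y) ge }

sgn-opposing : ∀ p → ∃[ b ] sgn b * p ≡ - ∣ p ∣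
sgn-opposing p with p≡±∣p∣ p
... | inj₁ eq = true  , trans (-1*x≈-x p) (cong -_ eq)
... | inj₂ eq = false , trans (*-identityˡ p) eq

∣sgn∣ : ∀ b p → ∣ sgn b * p ∣ ≡ ∣ p ∣
∣sgn∣ false p = cong ∣_∣ (*-identityˡ p)
∣sgn∣ true  p = trans (cong ∣_∣ (-1*x≈-x p)) (∣-p∣≡∣p∣ p)

bitℚ-nonNeg : ∀ b → 0ℚ ≤ bitℚ b
bitℚ-nonNeg false = ≤-refl
bitℚ-nonNeg true  = from-yes (0ℚ ≤? 1ℚ)

bitℚ-idem : ∀ b → bitℚ b * bitℚ b ≡ bitℚ b
bitℚ-idem false = refl
bitℚ-idem true  = refl

bitℚ-not : ∀ b → bitℚ (not b) ≡ 1ℚ + - bitℚ b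
bitℚ-not false = refl
bitℚ-not true  = refl

spectralNorm-nonNeg : (f : Cube n → ℚ) → 0ℚ ≤ spectralNorm f
spectralNorm-nonNeg {n} f = ≤-trans (≤-reflexive (sym (∑-zero {n}))) (∑-mono λ γ → 0≤∣p∣ (fourier f γ))

module BooleanSpectrum (f : Cube n → Bool) where
  F : Cube n → ℚ
  F x = bitℚ (f x)

  a : Cube n → ℚ
  a = fourier F

  p A : ℚ
  p = a 𝟎
  A = spectralNorm F

  -- The Fourier transform of f² = f.
  autoconvolution : ∀ δ → ∑ (λ γ → a γ * a (γ ⊕ δ)) ≡ a δ
  autoconvolution δ = trans (fourier-* F F δ)
    (cong (weight n *_) (∑-cong λ x → cong (_* χ δ x) (bitℚ-idem (f x))))

  parseval : ∑ (λ γ → a γ * a γ) ≡ p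
  parseval = trans (∑-cong λ γ → cong (λ δ → a γ * a δ) (sym (⊕-identityʳ γ))) (autoconvolution 𝟎)

  ∣a∣≤p : ∀ γ → ∣ a γ ∣ ≤ p
  ∣a∣≤p = ∣fourier∣≤fourier𝟎 F (λ x → bitℚ-nonNeg (f x))

  ∣p∣≡p : ∣ p ∣ ≡ p
  ∣p∣≡p = 0≤p⇒∣p∣≡p (≤-trans (0≤∣p∣ p) (∣a∣≤p 𝟎))

  1≤A : ∀ {x} → f x ≡ true → 1ℚ ≤ A
  1≤A {x} fx = ≤-trans (≤-reflexive (cong (λ b → ∣ bitℚ b ∣) (sym fx))) (∣f∣≤spectralNorm F x)

  -- Otherwise every coefficient has modulus at most p ≤ 0, so that A ≤ 0, against A ≥ 1.
  0<p : ∀ {x} → f x ≡ true → 0ℚ < p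
  0<p fx = ≰⇒> λ p≤0 → from-no (1ℚ ≤? 0ℚ) (≤-trans (1≤A fx)
    (≤-trans (∑-mono λ γ → ≤-trans (∣a∣≤p γ) p≤0) (≤-reflexive (∑-zero {n}))))

  -- Away from `𝟎` each square in Parseval's sum is at most M ∣a γ∣, and these moduli add up to A -
  -- p; the term at `𝟎` contributes p² exactly.
  parseval-bound : ∀ {M} → (∀ γ → γ ≢ 𝟎 → ∣ a γ ∣ ≤ M) → p ≤ M * A + (p * p + - (M * p))
  parseval-bound {M} ∣a∣≤M = begin
    p
      ≡⟨ parseval ⟨
    ∑ (λ γ → a γ * a γ)
      ≤⟨ ∑-mono-except-𝟎 (p * p + - (M * p)) off-𝟎 at-𝟎 ⟩
    ∑ (λ γ → M * ∣ a γ ∣) + (p * p + - (M * p))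
      ≡⟨ cong (λ s → s + (p * p + - (M * p))) (∑-*ˡ M (λ γ → ∣ a γ ∣)) ⟩
    M * A + (p * p + - (M * p)) ∎
    where
    open ≤-Reasoning
    off-𝟎 : ∀ γ → γ ≢ 𝟎 → a γ * a γ ≤ M * ∣ a γ ∣
    off-𝟎 γ γ≢𝟎 = ≤-trans (≤-reflexive (sym (∣p∣∣p∣≡pp (a γ))))
      (*-monoʳ-≤-nonNeg ∣ a γ ∣ {{nonNegative (0≤∣p∣ (a γ))}} (∣a∣≤M γ γ≢𝟎))
    at-𝟎 : p * p ≤ M * ∣ p ∣ + (p * p + - (M * p))
    at-𝟎 = ≤-reflexive (trans
      (solve 2 (λ p M → p :* p := M :* p :+ (p :* p :+ :- (M :* p))) refl p M)
      (cong (λ q → M * q + (p * p + - (M * p))) (sym ∣p∣≡p)))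

-- Restrict to the side of the hyperplane on which the largest nonconstant term
-- a α χ α is negative, so that the density p drops by M.
module Restriction (f : Cube (suc n) → Bool) {α : Cube (suc n)} (α≢𝟎 : α ≢ 𝟎)
  (α-max : ∀ γ → γ ≢ 𝟎 → ∣ fourier (λ x → bitℚ (f x)) γ ∣ ≤ ∣ fourier (λ x → bitℚ (f x)) α ∣) where

  open BooleanSpectrum f
  open HyperplaneChart (hyperplaneChart α α≢𝟎)

  M : ℚ
  M = ∣ a α ∣

  b : Bool
  b = proj₁ (sgn-opposing (a α))

  φ : AffineEmbedding n (suc n)
  φ = chart b

  g : Cube n → Bool
  g y = f (⟦ φ ⟧ y)

  module G = BooleanSpectrum g

  u w : Cube n → ℚ
  u β = a (lift β)
  w β = sgn b * a (lift β ⊕ α)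

  G-a : ∀ β → G.a β ≡ u β + w β
  G-a = fourier-chart (hyperplaneChart α α≢𝟎) F b

  u-𝟎 : u 𝟎 ≡ p
  u-𝟎 = cong a lift-𝟎

  w-𝟎 : w 𝟎 ≡ - M
  w-𝟎 = trans (cong (λ γ → sgn b * a γ) (trans (cong (_⊕ α) lift-𝟎) (⊕-identityˡ α)))
    (proj₂ (sgn-opposing (a α)))

  density-drop : G.p ≡ p + - M
  density-drop = trans (G-a 𝟎) (cong₂ _+_ u-𝟎 w-𝟎)

  ∑-∣u∣+∣w∣ : ∑ (λ β → ∣ u β ∣ + ∣ w β ∣) ≡ A
  ∑-∣u∣+∣w∣ = begin
    ∑ (λ β → ∣ u β ∣ + ∣ w β ∣)
      ≡⟨ ∑-+ (λ β → ∣ u β ∣) (λ β → ∣ w β ∣) ⟩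
    ∑ (λ β → ∣ u β ∣) + ∑ (λ β → ∣ w β ∣)
      ≡⟨ cong (λ s → ∑ (λ β → ∣ u β ∣) + s) (∑-cong λ β → ∣sgn∣ b (a (lift β ⊕ α))) ⟩
    ∑ (λ β → ∣ u β ∣) + ∑ (λ β → ∣ a (lift β ⊕ α) ∣)
      ≡⟨ ∑-lift (λ γ → ∣ a γ ∣) ⟨
    A ∎
    where open ≡-Reasoning

  -- The autoconvolution at `α` meets every pair {γ , γ ⊕ α} twice, once from each member, which
  -- accounts for the factor 2.
  ∑-2uw : ∑ (λ β → u β * w β + u β * w β) ≡ - M
  ∑-2uw = begin
    ∑ (λ β → u β * w β + u β * w β)
      ≡⟨ ∑-cong (λ β → trans
           (solve 3 (λ s x y → x :* (s :* y) :+ x :* (s :* y) := s :* (x :* y :+ y :* x)) refl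
             (sgn b) (u β) (a (lift β ⊕ α)))
           (cong (λ γ → sgn b * (u β * a (lift β ⊕ α) + a (lift β ⊕ α) * a γ))
             (sym (⊕-cancelʳ (lift β) α)))) ⟩
    ∑ (λ β → sgn b * (P (lift β) + P (lift β ⊕ α)))
      ≡⟨ ∑-*ˡ (sgn b) (λ β → P (lift β) + P (lift β ⊕ α)) ⟩
    sgn b * ∑ (λ β → P (lift β) + P (lift β ⊕ α))
      ≡⟨ cong (sgn b *_) (trans (∑-+ (P ∘ lift) (λ β → P (lift β ⊕ α))) (sym (∑-lift P))) ⟩
    sgn b * ∑ P
      ≡⟨ cong (sgn b *_) (autoconvolution α) ⟩
    sgn b * a α
      ≡⟨ proj₂ (sgn-opposing (a α)) ⟩
    - M ∎
    where
    open ≡-Reasoning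
    P : Cube (suc n) → ℚ
    P γ = a γ * a (γ ⊕ α)

  -- `scaled-∣+∣` is summed over all pairs but {𝟎 , α}, whose entry `p` may exceed `M`; `∑-2uw`
  -- evaluates the total of the products.
  norm-drop : M * G.A ≤ M * A + - M + ((p + p) * M + - (M + M) * M)
  norm-drop = begin
    M * G.A
      ≡⟨ ∑-*ˡ M (λ β → ∣ G.a β ∣) ⟨
    ∑ (λ β → M * ∣ G.a β ∣)
      ≡⟨ ∑-cong (λ β → cong (λ e → M * ∣ e ∣) (G-a β)) ⟩
    ∑ (λ β → M * ∣ u β + w β ∣)
      ≤⟨ ∑-mono-except-𝟎 K off-𝟎 at-𝟎 ⟩
    ∑ (λ β → M * (∣ u β ∣ + ∣ w β ∣) + (u β * w β + u β * w β)) + K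
      ≡⟨ cong (λ s → s + K) (trans
           (∑-+ (λ β → M * (∣ u β ∣ + ∣ w β ∣)) (λ β → u β * w β + u β * w β))
           (cong₂ _+_ (trans (∑-*ˡ M (λ β → ∣ u β ∣ + ∣ w β ∣)) (cong (M *_) ∑-∣u∣+∣w∣)) ∑-2uw)) ⟩
    M * A + - M + K ∎
    where
    open ≤-Reasoning
    K : ℚ
    -- Chosen to give equality at the pair {𝟎 , α}, where u = p and w = -M: M (p - M) = M (p + M) -
    -- 2pM + K.
    K = (p + p) * M + - (M + M) * M
    off-𝟎 : ∀ β → β ≢ 𝟎 →
            M * ∣ u β + w β ∣ ≤ M * (∣ u β ∣ + ∣ w β ∣) + (u β * w β + u β * w β)
    off-𝟎 β β≢𝟎 = scaled-∣+∣ (α-max (lift β) (β≢𝟎 ∘ lift-injective))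
      (≤-trans (≤-reflexive (∣sgn∣ b (a (lift β ⊕ α)))) (α-max (lift β ⊕ α) (lift⊕α≢𝟎 β)))
    at-𝟎ᵖ : M * ∣ p + - M ∣ ≤ M * (∣ p ∣ + ∣ - M ∣) + (p * - M + p * - M) + K
    at-𝟎ᵖ = ≤-reflexive (trans (cong (M *_) (0≤p⇒∣p∣≡p (≤⇒0≤- (∣a∣≤p α))))
      (trans
        (solve 2 (λ p M → M :* (p :+ :- M) :=
           M :* (p :+ M) :+ (p :* :- M :+ p :* :- M) :+ ((p :+ p) :* M :+ :- (M :+ M) :* M)) refl p M)
        (cong₂ (λ s t → M * (s + t) + (p * - M + p * - M) + K)
          (sym ∣p∣≡p) (sym (trans (∣-p∣≡∣p∣ M) (∣∣p∣∣≡∣p∣ (a α)))))))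
    at-𝟎 : M * ∣ u 𝟎 + w 𝟎 ∣ ≤ M * (∣ u 𝟎 ∣ + ∣ w 𝟎 ∣) + (u 𝟎 * w 𝟎 + u 𝟎 * w 𝟎) + K
    at-𝟎 = subst₂ (λ s t → M * ∣ s + t ∣ ≤ M * (∣ s ∣ + ∣ t ∣) + (s * t + s * t) + K)
      (sym u-𝟎) (sym w-𝟎) at-𝟎ᵖ

-- Induction on `n`, one hyperplane per step. The hypothesis p ≤ 1/2 survives because the density
-- falls to p - M, and each unit of codimension is paid for by a drop of at least 1 in A².
sparse-vanishes : ∀ n (f : Cube n → Bool) → let open BooleanSpectrum f in p + p ≤ 1ℚ →
  Σ[ d ∈ ℕ ] Σ[ c ∈ ℕ ] Σ[ φ ∈ AffineEmbedding d n ]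
    (d ℕ.+ c ≡ n × + c / 1 ≤ A * A × ∀ y → f (⟦ φ ⟧ y) ≡ false)
sparse-vanishes n f 2p≤1 with true-or-all-false f
sparse-vanishes n f 2p≤1 | inj₂ f≡false =
  n , 0 , idₐ , ℕ.+-identityʳ n , *-nonNeg 0≤A 0≤A , λ y → f≡false (⟦ idₐ ⟧ y)
  where 0≤A = spectralNorm-nonNeg (λ x → bitℚ (f x))
sparse-vanishes zero f 2p≤1 | inj₁ ([] , fx) = contradiction
  -- The density `p` unfolds to `q` in dimension 0, and equals 1 when `f` is `true` at the only
  -- point.
  (subst (λ e → let q = 1ℚ * (bitℚ e * 1ℚ) in q + q ≤ 1ℚ) fx 2p≤1)
  (from-no (1ℚ + 1ℚ ≤? 1ℚ))
sparse-vanishes (suc n) f 2p≤1 | inj₁ (x , fx)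
  with α , α≢𝟎 , α-max ← argmax-≢𝟎 (λ γ → ∣ fourier (λ x → bitℚ (f x)) γ ∣) =
  let d , c , ψ , d+c≡n , c≤A² , g≡false = sparse-vanishes n g 2G-p≤1
  in d , suc c , φ ∘ₐ ψ , trans (ℕ.+-suc d c) (cong suc d+c≡n) ,
     (begin
       + suc c / 1      ≡⟨ suc/1 c ⟩
       1ℚ + + c / 1     ≤⟨ +-monoʳ-≤ 1ℚ c≤A² ⟩
       1ℚ + G.A * G.A   ≤⟨ norm²-drop (0<p fx) 2p≤1 (0≤∣p∣ (a α)) (1≤A fx) (spectralNorm-nonNeg G.F)
                             (parseval-bound α-max) norm-drop ⟩
       A * A            ∎) ,
     λ y → trans (cong f (⟦∘ₐ⟧ φ ψ y)) (g≡false y)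
  where
  open ≤-Reasoning
  open BooleanSpectrum f
  open Restriction f α≢𝟎 α-max
  G-p≤p : G.p ≤ p
  G-p≤p = ≤-trans (≤-reflexive density-drop)
    (≤-by (0≤∣p∣ (a α)) (solve 2 (λ p M → p := p :+ :- M :+ M) refl p M))
  2G-p≤1 : G.p + G.p ≤ 1ℚ
  2G-p≤1 = ≤-trans (+-mono-≤ G-p≤p G-p≤p) 2p≤1

-- Passing to the complement: the spectrum of 1 - f.

module Complement (f : Cube n → Bool) where
  open BooleanSpectrum f
  module C = BooleanSpectrum (not ∘ f)

  C-a : ∀ γ → C.a γ ≡ weight n * ∑ (χ γ) + - a γ
  C-a γ = begin
    weight n * ∑ (λ x → bitℚ (not (f x)) * χ γ x)
      ≡⟨ cong (weight n *_) (∑-cong λ x → trans (cong (_* χ γ x) (bitℚ-not (f x)))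
           (solve 2 (λ a c → (con 1ℚ :+ :- a) :* c := c :+ con (- 1ℚ) :* (a :* c)) refl (F x) (χ γ x))) ⟩
    weight n * ∑ (λ x → χ γ x + - 1ℚ * (F x * χ γ x))
      ≡⟨ cong (weight n *_) (trans (∑-+ (χ γ) (λ x → - 1ℚ * (F x * χ γ x)))
           (cong (λ s → ∑ (χ γ) + s) (∑-*ˡ (- 1ℚ) (λ x → F x * χ γ x)))) ⟩
    weight n * (∑ (χ γ) + - 1ℚ * S)
      ≡⟨ solve 3 (λ w c s → w :* (c :+ con (- 1ℚ) :* s) := w :* c :+ :- (w :* s)) refl (weight n) (∑ (χ γ)) S ⟩
    weight n * ∑ (χ γ) + - a γ ∎
    where
    open ≡-Reasoning
    S = ∑ (λ x → F x * χ γ x)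

  C-p : C.p ≡ 1ℚ + - p
  C-p = trans (C-a 𝟎) (cong (λ s → s + - p)
    (trans (cong (weight n *_) (∑-cong {n} λ x → cong sgn (⟨𝟎,-⟩ x))) (weight*∑1 {n})))

  C-a-off-𝟎 : ∀ γ → γ ≢ 𝟎 → C.a γ ≡ - a γ
  C-a-off-𝟎 γ γ≢𝟎 = trans (C-a γ) (trans
    (cong (λ s → s + - a γ) (trans (cong (weight n *_) (∑-χ γ γ≢𝟎)) (*-zeroʳ (weight n))))
    (+-identityˡ (- a γ)))

  module _ (1≤2p : 1ℚ ≤ p + p) where

    C-sparse : C.p + C.p ≤ 1ℚ
    C-sparse = ≤-trans (≤-reflexive (cong₂ _+_ C-p C-p)) (≤-by (≤⇒0≤- 1≤2p)
      (solve 1 (λ p → con 1ℚ := (con 1ℚ :+ :- p) :+ (con 1ℚ :+ :- p) :+ (p :+ p :+ :- con 1ℚ)) refl p))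

    -- Off `𝟎` the coefficients only change sign, and at `𝟎` the modulus goes from p to ∣1 - p∣,
    -- which is at most p when p ≥ 1/2.
    C-norm : C.A ≤ A
    C-norm = ≤-trans (∑-mono-except-𝟎 0ℚ off-𝟎 at-𝟎) (≤-reflexive (+-identityʳ A))
      where
      off-𝟎 : ∀ γ → γ ≢ 𝟎 → ∣ C.a γ ∣ ≤ ∣ a γ ∣
      off-𝟎 γ γ≢𝟎 = ≤-reflexive (trans (cong ∣_∣ (C-a-off-𝟎 γ γ≢𝟎)) (∣-p∣≡∣p∣ (a γ)))
      1-p≤p : 1ℚ + - p ≤ p
      1-p≤p = ≤-by (≤⇒0≤- 1≤2p) (solve 1 (λ p → p := con 1ℚ :+ :- p :+ (p :+ p :+ :- con 1ℚ)) refl p)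
      -[1-p]≤p : - (1ℚ + - p) ≤ p
      -[1-p]≤p = ≤-by (bitℚ-nonNeg true) (solve 1 (λ p → p := :- (con 1ℚ :+ :- p) :+ con 1ℚ) refl p)
      at-𝟎 : ∣ C.p ∣ ≤ ∣ p ∣ + 0ℚ
      at-𝟎 = begin
        ∣ C.p ∣       ≡⟨ cong ∣_∣ C-p ⟩
        ∣ 1ℚ + - p ∣  ≤⟨ ∣∣-lub 1-p≤p -[1-p]≤p ⟩
        p             ≡⟨ trans (+-identityʳ ∣ p ∣) ∣p∣≡p ⟨
        ∣ p ∣ + 0ℚ    ∎
        where open ≤-Reasoning

-- From embeddings to affine subspaces, and the conclusion.

image-codimension : ∀ {c} (φ : AffineEmbedding d n) → d ℕ.+ c ≡ n → HasCodimension (image φ) c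
image-codimension {d = d} φ d+c≡n = d , range-dimension (linear φ) , d+c≡n

image-constant : (f : Cube n → Bool) (φ : AffineEmbedding d n) {b : Bool} →
                 (∀ y → f (⟦ φ ⟧ y) ≡ b) → ConstantOn f (image φ)
image-constant f φ {b} eq = b , λ { _ (_ , (y , refl) , refl) → eq y }

theorem1p1 : (n : ℕ) → 1 ≤ℕ n → (f : Cube n → Bool) (A : ℚ) →
    spectralNorm (λ x → bitℚ (f x)) ≡ A →
    Σ[ V ∈ AffineSubspace n ] Σ[ c ∈ ℕ ]
    (HasCodimension V c × (+ c / 1) ≤ A * A × ConstantOn f V)
theorem1p1 n _ f _ refl with ≤-total (p + p) 1ℚ
  where open BooleanSpectrum f
... | inj₁ 2p≤1 =
  let d , c , φ , d+c≡n , c≤A² , f≡false = sparse-vanishes n f 2p≤1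
  in image φ , c , image-codimension φ d+c≡n , c≤A² , image-constant f φ f≡false
-- For a dense `f` the complement is sparse; where it vanishes `f` is constantly `true`, and
-- `C-norm` transfers the codimension bound.
... | inj₂ 1≤2p =
  let open BooleanSpectrum f
      open Complement f
      d , c , φ , d+c≡n , c≤C² , notf≡false = sparse-vanishes n (not ∘ f) (C-sparse 1≤2p)
      C²≤A² = ≤-trans
        (*-monoˡ-≤-nonNeg C.A {{nonNegative (spectralNorm-nonNeg C.F)}} (C-norm 1≤2p))
        (*-monoʳ-≤-nonNeg A {{nonNegative (spectralNorm-nonNeg F)}} (C-norm 1≤2p))
  in image φ , c , image-codimension φ d+c≡n , ≤-trans c≤C² C²≤A² ,
     image-constant f φ λ y → not-injective (notf≡false y)
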